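{- Let $k\geq 1$. The generating function of the number of edges of the Munarini graphs $M_{n,k}$ is $$\sum_{n\geq 0}|E(M_{n,k})|\,t^n=\frac{(k-1)t+t^2}{(1-kt-t^2)^2}$$ as formal power series in $t$.
   Context: For integers $k\geq 1$, $n\geq 0$, a $k$-generalized Pell string of length $n$ is a word of length $n$ over the alphabet $\{0,1,\ldots,k\}$ in which every maximal run of the character $k$ has even length (equivalently, a concatenation of letters from $\{0,1,\ldots,k-1,kk\}$). Let $\mathcal{F}_{n,k}$ be the set of these strings (for $n=0$ it contains only the empty string). The Munarini graph $M_{n,k}$ is the simple graph with vertex set $\mathcal{F}_{n,k}$ in which two vertices are adjacent if one of them can be obtained from the other either by replacing one occurrence of $0$ with some $i\in\{1,\ldots,k-1\}$, or by replacing one substring $00$ (two consecutive positions) with $kk$ (both replacements may be read in either direction, and both strings must be in $\mathcal{F}_{n,k}$). -}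

module Defs where

open import Data.Empty using (⊥-elim)
open import Data.Fin.Base using (Fin; zero; fromℕ)
import Data.Fin.Properties as Fin
open import Data.Integer.Base as ℤ using (ℤ; +_; 0ℤ; 1ℤ)
import Data.Integer.Properties as ℤ
open import Data.List.Base as List using (List; []; _∷_; _++_)
open import Data.List.Membership.Propositional using (_∈_)
open import Data.List.Membership.Propositional.Properties using (∈-filter⁺; ∈-filter⁻; ∈-allFin; ∈-cartesianProductWith⁺)
import Data.List.Properties as List
open import Data.List.Relation.Unary.Any using (here)
import Data.List.Relation.Unary.All as All
import Data.List.Relation.Unary.AllPairs as AllPairs
open import Data.List.Relation.Unary.Unique.Propositional using (Unique)
import Data.List.Relation.Unary.Unique.Propositional.Properties as Unique
open import Data.Maybe.Base using (just)
open import Data.Nat.Base as ℕ using (ℕ; zero; suc; _∸_)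
open import Data.Nat.Divisibility using (_∣_; _∣0; ∣-refl; ∣m∣n⇒∣m+n; ∣m+n∣m⇒∣n; _∣?_)
open import Data.Product.Base using (_×_; _,_; proj₁; proj₂; uncurry)
open import Data.Sum.Base using (_⊎_; inj₁; inj₂)
open import Data.Vec.Base as Vec using (Vec; []; _∷_; toList)
import Data.Vec.Properties as Vec
open import Function.Base using (_$_)
open import Function.Bundles using (_⇔_; mk⇔)
open import Relation.Binary.PropositionalEquality using (_≡_; _≢_; refl; sym; cong; module ≡-Reasoning)
open import Relation.Nullary.Decidable using (Dec; yes; no; map′; _×-dec_; _⊎-dec_; ¬?; True; toWitness; from-no)

------------------------------------------------------------------------
-- Generalized Pell strings

Letter : ℕ → Set
Letter k = Fin (suc k)

Word : ℕ → ℕ → Set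
Word n k = Vec (Letter k) n

top : ∀ {k} → Letter k
top {k} = fromℕ k

-- A factorization a ++ topᵐ ++ b in which a does not end with top and b
-- does not begin with it exhibits topᵐ as a maximal run.  The case m = 0
-- is included but imposes no condition.
EvenRuns : ∀ {k} → List (Letter k) → Set
EvenRuns w = ∀ a m b → w ≡ a ++ List.replicate m top ++ b →
             List.last a ≢ just top → List.head b ≢ just top → 2 ∣ m

IsPell : ∀ {n k} → Word n k → Set
IsPell w = EvenRuns (toList w)

-- Concatenations of 0, 1, …, k-1, kk; this is used to decide IsPell.
data Concatenation {k} : List (Letter k) → Set where
  []     : Concatenation []
  letter : ∀ {x w} → x ≢ top → Concatenation w → Concatenation (x ∷ w)
  double : ∀ {w} → Concatenation w → Concatenation (top ∷ top ∷ w)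

private
  last-∷ : ∀ {k} {x : Letter k} a → x ≢ top →
           List.last a ≢ just top → List.last (x ∷ a) ≢ just top
  last-∷ []      x≢ _  refl = x≢ refl
  last-∷ (_ ∷ _) _  a≢ = a≢

  last-tail : ∀ {k} {x : Letter k} a →
              List.last (x ∷ a) ≢ just top → List.last a ≢ just top
  last-tail []      _  ()
  last-tail (_ ∷ _) a≢ = a≢

  2∤1 : 2 ∣ 1 → ∀ {A : Set} → A
  2∤1 d = ⊥-elim (from-no (2 ∣? 1) d)

evenRuns⇒concatenation : ∀ {k} (w : List (Letter k)) → EvenRuns w → Concatenation w
evenRuns⇒concatenation [] _ = []
evenRuns⇒concatenation (x ∷ w) p with x Fin.≟ top
... | no x≢ = letter x≢ $ evenRuns⇒concatenation w λ a m b eq a≢ b≢ →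
  p (x ∷ a) m b (cong (x ∷_) eq) (last-∷ a x≢ a≢) b≢
evenRuns⇒concatenation (x ∷ []) p | yes refl =
  2∤1 (p [] 1 [] refl (λ ()) (λ ()))
evenRuns⇒concatenation (x ∷ y ∷ w) p | yes refl with y Fin.≟ top
... | no y≢ = 2∤1 (p [] 1 (y ∷ w) refl (λ ()) λ { refl → y≢ refl })
... | yes refl = double $ evenRuns⇒concatenation w λ where
  []        m b eq a≢ b≢ → ∣m+n∣m⇒∣n
    (p [] (2 ℕ.+ m) b (cong (λ v → top ∷ top ∷ v) eq) (λ ()) b≢) ∣-refl
  a@(_ ∷ _) m b eq a≢ b≢ →
    p (top ∷ top ∷ a) m b (cong (λ v → top ∷ top ∷ v) eq) a≢ b≢

concatenation⇒evenRuns : ∀ {k} {w : List (Letter k)} → Concatenation w → EvenRuns w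
concatenation⇒evenRuns [] []      zero    b eq a≢ b≢ = 2 ∣0
concatenation⇒evenRuns [] []      (suc m) b () a≢ b≢
concatenation⇒evenRuns [] (_ ∷ _) m       b () a≢ b≢
concatenation⇒evenRuns (letter x≢ c) []      zero    b eq a≢ b≢ = 2 ∣0
concatenation⇒evenRuns (letter x≢ c) []      (suc m) b eq a≢ b≢ =
  ⊥-elim (x≢ (List.∷-injectiveˡ eq))
concatenation⇒evenRuns (letter x≢ c) (y ∷ a) m       b eq a≢ b≢ =
  concatenation⇒evenRuns c a m b (List.∷-injectiveʳ eq) (last-tail a a≢) b≢
concatenation⇒evenRuns (double c) [] zero b eq a≢ b≢ = 2 ∣0
concatenation⇒evenRuns (double c) [] (suc zero) b eq a≢ b≢ =
  ⊥-elim (b≢ (sym (cong List.head (List.∷-injectiveʳ eq))))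
concatenation⇒evenRuns (double c) [] (suc (suc m)) b eq a≢ b≢ =
  ∣m∣n⇒∣m+n ∣-refl (concatenation⇒evenRuns c [] m b
    (List.∷-injectiveʳ (List.∷-injectiveʳ eq)) (λ ()) b≢)
concatenation⇒evenRuns (double c) (y ∷ []) m b eq a≢ b≢ =
  ⊥-elim (a≢ (cong just (sym (List.∷-injectiveˡ eq))))
concatenation⇒evenRuns (double c) (y ∷ z ∷ a) m b eq a≢ b≢ =
  concatenation⇒evenRuns c a m b (List.∷-injectiveʳ (List.∷-injectiveʳ eq))
    (last-tail a a≢) b≢

concatenation? : ∀ {k} (w : List (Letter k)) → Dec (Concatenation w)
concatenation? [] = yes []
concatenation? (x ∷ w) with x Fin.≟ top
... | no x≢ = map′ (letter x≢)
  (λ { (letter _ c) → c ; (double _) → ⊥-elim (x≢ refl) }) (concatenation? w)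
concatenation? (x ∷ []) | yes refl = no λ { (letter x≢ _) → x≢ refl }
concatenation? (x ∷ y ∷ w) | yes refl with y Fin.≟ top
... | no y≢ = no λ { (letter x≢ _) → x≢ refl ; (double _) → y≢ refl }
... | yes refl = map′ double
  (λ { (letter x≢ _) → ⊥-elim (x≢ refl) ; (double c) → c }) (concatenation? w)

isPell? : ∀ {n k} (w : Word n k) → Dec (IsPell w)
isPell? w = map′ concatenation⇒evenRuns (evenRuns⇒concatenation (toList w))
  (concatenation? (toList w))

------------------------------------------------------------------------
-- Munarini graphs

infix 4 _⇝_ _⇝?_ _~_ _~?_

-- u ⇝ v: v arises from u by one replacement 0 → i with 1 ≤ i ≤ k-1, or by
-- one replacement 00 → kk.
data _⇝_ {k} : ∀ {n} → Word n k → Word n k → Set where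
  single : ∀ {n} {w : Word n k} i → i ≢ zero → i ≢ top → zero ∷ w ⇝ i ∷ w
  pair   : ∀ {n} {w : Word n k} → zero ∷ zero ∷ w ⇝ top ∷ top ∷ w
  there  : ∀ {n} {u v : Word n k} x → u ⇝ v → x ∷ u ⇝ x ∷ v

_~_ : ∀ {n k} → Word n k → Word n k → Set
u ~ v = (u ⇝ v) ⊎ (v ⇝ u)

private
  _≟ʷ_ : ∀ {n k} (u v : Word n k) → Dec (u ≡ v)
  _≟ʷ_ = Vec.≡-dec Fin._≟_

_⇝?_ : ∀ {n k} (u v : Word n k) → Dec (u ⇝ v)
[] ⇝? [] = no λ ()
(x ∷ []) ⇝? (y ∷ []) = map′
  (λ { (refl , i≢0 , i≢k) → single y i≢0 i≢k })
  (λ { (single _ i≢0 i≢k) → refl , i≢0 , i≢k ; (there _ ()) })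
  (x Fin.≟ zero ×-dec ¬? (y Fin.≟ zero) ×-dec ¬? (y Fin.≟ top))
(x ∷ u@(x′ ∷ u′)) ⇝? (y ∷ v@(y′ ∷ v′)) = map′
  (λ { (inj₁ (refl , i≢0 , i≢k , refl)) → single y i≢0 i≢k
     ; (inj₂ (inj₁ (refl , refl , refl , refl , refl))) → pair
     ; (inj₂ (inj₂ (refl , r))) → there x r })
  (λ { (single _ i≢0 i≢k) → inj₁ (refl , i≢0 , i≢k , refl)
     ; pair → inj₂ (inj₁ (refl , refl , refl , refl , refl))
     ; (there _ r) → inj₂ (inj₂ (refl , r)) })
  ((x Fin.≟ zero ×-dec ¬? (y Fin.≟ zero) ×-dec ¬? (y Fin.≟ top) ×-dec u ≟ʷ v)
   ⊎-dec (x Fin.≟ zero ×-dec x′ Fin.≟ zero ×-dec y Fin.≟ top ×-dec y′ Fin.≟ top ×-dec u′ ≟ʷ v′)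
   ⊎-dec (x Fin.≟ y ×-dec u ⇝? v))

_~?_ : ∀ {n k} (u v : Word n k) → Dec (u ~ v)
u ~? v = u ⇝? v ⊎-dec v ⇝? u

words : ∀ n k → List (Word n k)
words zero    k = [] ∷ []
words (suc n) k = List.cartesianProductWith _∷_ (List.allFin (suc k)) (words n k)

vertices : ∀ n k → List (Word n k)
vertices n k = List.filter isPell? (words n k)

-- The 2-element sub-collections of a duplicate-free list, each listed once.
unorderedPairs : ∀ {A : Set} → List A → List (A × A)
unorderedPairs []       = []
unorderedPairs (x ∷ xs) = List.map (x ,_) xs ++ unorderedPairs xs

edges : ∀ n k → List (Word n k × Word n k)
edges n k = List.filter (uncurry _~?_) (unorderedPairs (vertices n k))

∣E∣ : ℕ → ℕ → ℕ
∣E∣ n k = List.length (edges n k)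

∈-words : ∀ {n k} (w : Word n k) → w ∈ words n k
∈-words []      = here refl
∈-words (x ∷ w) = ∈-cartesianProductWith⁺ _∷_ (∈-allFin x) (∈-words w)

words-unique : ∀ n k → Unique (words n k)
words-unique zero    k = All.[] AllPairs.∷ AllPairs.[]
words-unique (suc n) k = Unique.cartesianProductWith⁺ _∷_ Vec.∷-injective
  (Unique.allFin⁺ (suc k)) (words-unique n k)

∈-vertices : ∀ {n k} (w : Word n k) → w ∈ vertices n k ⇔ IsPell w
∈-vertices {n} {k} w = mk⇔ (λ w∈ → proj₂ (∈-filter⁻ isPell? {xs = words n k} w∈))
  (∈-filter⁺ isPell? (∈-words w))

vertices-unique : ∀ n k → Unique (vertices n k)
vertices-unique n k = Unique.filter⁺ isPell? (words-unique n k)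

------------------------------------------------------------------------
-- Formal power series over ℤ, given by their coefficients

Series : Set
Series = ℕ → ℤ

infix  4 _≈_
infixl 6 _+_ _-_
infixl 7 _*_ _/_
infixr 8 _^_
infix  9 _·t^_

_≈_ : Series → Series → Set
f ≈ g = ∀ n → f n ≡ g n

_·t^_ : ℤ → ℕ → Series
(c ·t^ zero)  zero    = c
(c ·t^ zero)  (suc n) = 0ℤ
(c ·t^ suc m) zero    = 0ℤ
(c ·t^ suc m) (suc n) = (c ·t^ m) n

_+_ _-_ _*_ : Series → Series → Series
(f + g) n = f n ℤ.+ g n
(f - g) n = f n ℤ.- g n
(f * g) n = List.foldr ℤ._+_ 0ℤ (List.applyUpTo (λ i → f i ℤ.* g (n ∸ i)) (suc n))

_^_ : Series → ℕ → Series
f ^ zero  = 1ℤ ·t^ 0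
f ^ suc m = f * f ^ m

-- Long division by a series with constant term 1: the quotient is
-- f₀ + t·q, where q is the quotient of (f - f₀ g) / t by g.
_/_ : (f g : Series) {_ : True (g 0 ℤ.≟ 1ℤ)} → Series
(f / g)     zero    = f 0
(f / g) {p} (suc n) = ((λ m → f (suc m) ℤ.- f 0 ℤ.* g (suc m)) / g) {p} n

/-*-cancel : ∀ f g {p : True (g 0 ℤ.≟ 1ℤ)} → (f / g) {p} * g ≈ f
/-*-cancel f g {p} zero = begin
  f 0 ℤ.* g 0 ℤ.+ 0ℤ ≡⟨ ℤ.+-identityʳ _ ⟩
  f 0 ℤ.* g 0        ≡⟨ cong (f 0 ℤ.*_) (toWitness p) ⟩
  f 0 ℤ.* 1ℤ         ≡⟨ ℤ.*-identityʳ (f 0) ⟩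
  f 0                ∎
  where open ≡-Reasoning
/-*-cancel f g {p} (suc n) = begin
  f 0 ℤ.* g (suc n) ℤ.+ ((f′ / g) {p} * g) n
    ≡⟨ cong (λ z → f 0 ℤ.* g (suc n) ℤ.+ z) (/-*-cancel f′ g {p} n) ⟩
  f 0 ℤ.* g (suc n) ℤ.+ (f (suc n) ℤ.- f 0 ℤ.* g (suc n))
    ≡⟨ ℤ.+-comm (f 0 ℤ.* g (suc n)) _ ⟩
  f (suc n) ℤ.- f 0 ℤ.* g (suc n) ℤ.+ f 0 ℤ.* g (suc n)
    ≡⟨ ℤ.+-assoc (f (suc n)) _ _ ⟩
  f (suc n) ℤ.+ (ℤ.- (f 0 ℤ.* g (suc n)) ℤ.+ f 0 ℤ.* g (suc n))
    ≡⟨ cong (λ z → f (suc n) ℤ.+ z) (ℤ.+-inverseˡ (f 0 ℤ.* g (suc n))) ⟩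
  f (suc n) ℤ.+ 0ℤ
    ≡⟨ ℤ.+-identityʳ _ ⟩
  f (suc n) ∎
  where
  open ≡-Reasoning
  f′ : Series
  f′ m = f (suc m) ℤ.- f 0 ℤ.* g (suc m)

edgeSeries : ℕ → Series
edgeSeries k n = + ∣E∣ n k

{-# OPTIONS --safe #-}

-- Orienting every edge from the string with more zeros to the other one
-- identifies edges with arcs u ⇝ v between Pell strings.  Reading off the first
-- block (a letter x < k, or kk) splits the vertices and the arcs: either both
-- ends of the arc share that block, or the arc is 0w ⇝ iw or 00w ⇝ kkw.  Hence
--   V(n+2) = k V(n+1) + V(n),
--   E(n+2) = k E(n+1) + (k-1) V(n+1) + E(n) + V(n),
-- that is, (1 - kt - t²) V = 1 and (1 - kt - t²) E = ((k-1) t + t²) V.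
module Submission where

open import Defs
open import Data.Empty using (⊥-elim)
open import Data.Fin.Base using (zero; suc; inject₁)
import Data.Fin.Properties as Fin
open import Data.Fin.Relation.Unary.Top using (view; ‵fromℕ; ‵inject₁)
open import Data.Integer.Base as ℤ using (ℤ; +_; 0ℤ; 1ℤ)
import Data.Integer.Properties as ℤ
open import Data.Integer.Tactic.RingSolver renaming (solve-∀ to ℤ-solve-∀) using ()
open import Data.List.Base as List using (List; []; _∷_; _++_; length; map; filter; allFin; cartesianProduct; cartesianProductWith)
open import Data.List.Membership.Propositional using (_∈_)
open import Data.List.Membership.Propositional.Properties
open import Data.List.Membership.Propositional.Properties.WithK using (unique∧set⇒bag)
import Data.List.Properties as List
open import Data.List.Relation.Binary.BagAndSetEquality using (∼bag⇒↭)
open import Data.List.Relation.Binary.Disjoint.Propositional using (Disjoint)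
open import Data.List.Relation.Binary.Permutation.Propositional.Properties using (↭-length)
import Data.List.Relation.Unary.AllPairs as AllPairs
open import Data.List.Relation.Unary.Unique.Propositional using (Unique)
import Data.List.Relation.Unary.Unique.Propositional.Properties as Unique
open import Data.Nat.Base as ℕ using (ℕ; zero; suc)
import Data.Nat.Properties as ℕ
open import Data.Nat.Tactic.RingSolver renaming (solve-∀ to ℕ-solve-∀) using ()
open import Data.Product.Base using (_×_; _,_; proj₁; proj₂; uncurry)
open import Data.Sum.Base using (_⊎_; inj₁; inj₂; [_,_]′)
open import Data.Vec.Base using ([]; _∷_; toList)
import Data.Vec.Properties as Vec
open import Function.Base using (_∘_)
open import Function.Bundles using (_⇔_; mk⇔; Equivalence)
open import Relation.Binary.Definitions using (Decidable; Asymmetric)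
open import Relation.Binary.PropositionalEquality
open import Relation.Nullary.Decidable using (True; toWitness; yes; no; _⊎-dec_)
import Relation.Unary as Unary
open ≡-Reasoning

-- Counting in lists

private variable
  A B C : Set

count : {P : A → Set} → Unary.Decidable P → List A → ℕ
count P? xs = length (filter P? xs)

count-++ : {P : A → Set} (P? : Unary.Decidable P) (xs ys : List A) →
  count P? (xs ++ ys) ≡ count P? xs ℕ.+ count P? ys
count-++ P? xs ys = trans (cong length (List.filter-++ P? xs ys)) (List.length-++ (filter P? xs))

length-cartesianProductWith : (f : A → B → C) (xs : List A) (ys : List B) →
  length (cartesianProductWith f xs ys) ≡ length xs ℕ.* length ys
length-cartesianProductWith f []       ys = refl
length-cartesianProductWith f (x ∷ xs) ys = begin
  length (map (f x) ys ++ cartesianProductWith f xs ys)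
    ≡⟨ List.length-++ (map (f x) ys) ⟩
  length (map (f x) ys) ℕ.+ length (cartesianProductWith f xs ys)
    ≡⟨ cong₂ ℕ._+_ (List.length-map (f x) ys) (length-cartesianProductWith f xs ys) ⟩
  length ys ℕ.+ length xs ℕ.* length ys ∎

-- Without repetitions, equality as sets is already equality as bags, so the lists are permutations
-- of each other. Every count below is obtained by comparing memberships in this way.
unique-length : {xs ys : List A} → Unique xs → Unique ys →
  (∀ {x} → x ∈ xs ⇔ x ∈ ys) → length xs ≡ length ys
unique-length uxs uys xs⇔ys = ↭-length (∼bag⇒↭ (unique∧set⇒bag uxs uys xs⇔ys))

module _ {R : A → A → Set} (R? : Decidable R) where

  private
    S? : Unary.Decidable (uncurry λ x y → R x y ⊎ R y x)
    S? (x , y) = R? x y ⊎-dec R? y x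

    #R #S : List (A × A) → ℕ
    #R = count (uncurry R?)
    #S = count S?

  -- `cartesianProduct` recurses on its left argument only. Peeling a column off the right argument
  -- is what an induction over the square of a list needs.
  count-cartesianProduct-∷ʳ : ∀ xs y ys →
    #R (cartesianProduct xs (y ∷ ys)) ≡ #R (map (_, y) xs) ℕ.+ #R (cartesianProduct xs ys)
  count-cartesianProduct-∷ʳ []       y ys = refl
  count-cartesianProduct-∷ʳ (x ∷ xs) y ys = begin
    #R (((x , y) ∷ []) ++ map (x ,_) ys ++ cartesianProduct xs (y ∷ ys))
      ≡⟨ count-++ (uncurry R?) ((x , y) ∷ []) _ ⟩
    a ℕ.+ #R (map (x ,_) ys ++ cartesianProduct xs (y ∷ ys))
      ≡⟨ cong (a ℕ.+_) (count-++ (uncurry R?) (map (x ,_) ys) _) ⟩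
    a ℕ.+ (b ℕ.+ #R (cartesianProduct xs (y ∷ ys)))
      ≡⟨ cong (λ z → a ℕ.+ (b ℕ.+ z)) (count-cartesianProduct-∷ʳ xs y ys) ⟩
    a ℕ.+ (b ℕ.+ (#R (map (_, y) xs) ℕ.+ #R (cartesianProduct xs ys)))
      ≡⟨ lemma a b (#R (map (_, y) xs)) _ ⟩
    (a ℕ.+ #R (map (_, y) xs)) ℕ.+ (b ℕ.+ #R (cartesianProduct xs ys))
      ≡⟨ cong₂ ℕ._+_ (count-++ (uncurry R?) ((x , y) ∷ []) _) (count-++ (uncurry R?) (map (x ,_) ys) _) ⟨
    #R (map (_, y) (x ∷ xs)) ℕ.+ #R (cartesianProduct (x ∷ xs) ys) ∎
    where
    a b : ℕ
    a = #R ((x , y) ∷ [])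
    b = #R (map (x ,_) ys)
    lemma : ∀ a b c d → a ℕ.+ (b ℕ.+ (c ℕ.+ d)) ≡ (a ℕ.+ c) ℕ.+ (b ℕ.+ d)
    lemma = ℕ-solve-∀

  module _ (asym : Asymmetric R) where

    -- Asymmetry makes the two disjuncts of `S?` mutually exclusive, so their counts add up.
    count-row : ∀ x ys → #S (map (x ,_) ys) ≡ #R (map (x ,_) ys) ℕ.+ #R (map (_, x) ys)
    count-row x []       = refl
    count-row x (y ∷ ys) with R? x y | R? y x
    ... | yes r | yes s = ⊥-elim (asym r s)
    ... | yes r | no  _ = cong suc (count-row x ys)
    ... | no  _ | yes s = trans (cong suc (count-row x ys)) (sym (ℕ.+-suc _ _))
    ... | no  _ | no  _ = count-row x ys

    -- A related pair is related in exactly one direction, so it is met once in the square.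
    -- Asymmetry also implies irreflexivity, so the diagonal contributes nothing.
    count-unorderedPairs : ∀ xs → #S (unorderedPairs xs) ≡ #R (cartesianProduct xs xs)
    count-unorderedPairs []       = refl
    count-unorderedPairs (x ∷ xs) with R? x x
    ... | yes r = ⊥-elim (asym r r)
    ... | no  _ = begin
      #S (map (x ,_) xs ++ unorderedPairs xs)
        ≡⟨ count-++ S? (map (x ,_) xs) _ ⟩
      #S (map (x ,_) xs) ℕ.+ #S (unorderedPairs xs)
        ≡⟨ cong₂ ℕ._+_ (count-row x xs) (count-unorderedPairs xs) ⟩
      (#R (map (x ,_) xs) ℕ.+ #R (map (_, x) xs)) ℕ.+ #R (cartesianProduct xs xs)
        ≡⟨ ℕ.+-assoc (#R (map (x ,_) xs)) _ _ ⟩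
      #R (map (x ,_) xs) ℕ.+ (#R (map (_, x) xs) ℕ.+ #R (cartesianProduct xs xs))
        ≡⟨ cong (#R (map (x ,_) xs) ℕ.+_) (count-cartesianProduct-∷ʳ xs x xs) ⟨
      #R (map (x ,_) xs) ℕ.+ #R (cartesianProduct xs (x ∷ xs))
        ≡⟨ count-++ (uncurry R?) (map (x ,_) xs) _ ⟨
      #R (map (x ,_) xs ++ cartesianProduct xs (x ∷ xs)) ∎

-- Arcs between Pell strings

-- At the first position where the words differ, an arc turns `zero` into another letter. The index
-- is `suc j` because for k = 0 the letters `zero` and `top` coincide and `pair` becomes a loop.
⇝-asym : ∀ {n j} → Asymmetric (_⇝_ {suc j} {n})
⇝-asym (single i i≢0 _) (single _ 0≢0 _) = 0≢0 refl
⇝-asym (single i i≢0 _) (there _ _)      = i≢0 refl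
⇝-asym pair             ()
⇝-asym (there _ r)      (single _ i≢0 _) = i≢0 refl
⇝-asym (there _ r)      (there _ s)      = ⇝-asym r s

∈-vertices⁺ : ∀ {n k} {w : Word n k} → Concatenation (toList w) → w ∈ vertices n k
∈-vertices⁺ {w = w} c = Equivalence.from (∈-vertices w) (concatenation⇒evenRuns c)

∈-vertices⁻ : ∀ {n k} {w : Word n k} → w ∈ vertices n k → Concatenation (toList w)
∈-vertices⁻ {w = w} w∈ = evenRuns⇒concatenation (toList w) (Equivalence.to (∈-vertices w) w∈)

-- The outermost block of a `Concatenation`, stated on vectors. Matching on it refines the word
-- itself, whereas `Concatenation` is indexed by the stuck list `toList w`.
data Factored {k} : ∀ {n} → Word (suc n) k → Set where
  letter : ∀ {n x} {w : Word n k} → x ≢ top → Concatenation (toList w) → Factored (x ∷ w)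
  double : ∀ {n} {w : Word n k} → Concatenation (toList w) → Factored (top ∷ top ∷ w)

factor : ∀ {n k} (w : Word (suc n) k) → Concatenation (toList w) → Factored w
factor (_ ∷ [])    (letter x≢ c) = letter x≢ c
factor (_ ∷ _ ∷ _) (letter x≢ c) = letter x≢ c
factor (_ ∷ _ ∷ _) (double c)    = double c

Arc : ℕ → ℕ → Set
Arc n k = Word n k × Word n k

arcs : ∀ n k → List (Arc n k)
arcs n k = filter (uncurry _⇝?_) (cartesianProduct (vertices n k) (vertices n k))

arcs-unique : ∀ n k → Unique (arcs n k)
arcs-unique n k = Unique.filter⁺ (uncurry _⇝?_)
  (Unique.cartesianProduct⁺ (vertices-unique n k) (vertices-unique n k))

∈-arcs⁺ : ∀ {n k} {u v : Word n k} →
  Concatenation (toList u) → Concatenation (toList v) → u ⇝ v → (u , v) ∈ arcs n k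
∈-arcs⁺ cu cv r = ∈-filter⁺ (uncurry _⇝?_) (∈-cartesianProduct⁺ (∈-vertices⁺ cu) (∈-vertices⁺ cv)) r

∈-arcs⁻ : ∀ {n k} {u v : Word n k} → (u , v) ∈ arcs n k →
  Concatenation (toList u) × Concatenation (toList v) × u ⇝ v
∈-arcs⁻ {n} {k} uv∈
  with p , r ← ∈-filter⁻ (uncurry _⇝?_) {xs = cartesianProduct (vertices n k) (vertices n k)} uv∈
  with u∈ , v∈ ← ∈-cartesianProduct⁻ (vertices n k) (vertices n k) p
  = ∈-vertices⁻ u∈ , ∈-vertices⁻ v∈ , r

-- For `_⇝?_` the test `S?` is `uncurry _~?_` by computation, so the general count of unordered
-- pairs applies directly.
∣E∣≡∣arcs∣ : ∀ n j → ∣E∣ n (suc j) ≡ length (arcs n (suc j))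
∣E∣≡∣arcs∣ n j = count-unorderedPairs _⇝?_ ⇝-asym (vertices n (suc j))

-- Splitting off the first block

nonTops : ∀ k → List (Letter k)
nonTops k = map inject₁ (allFin k)

∈-nonTops⁺ : ∀ {k} {x : Letter k} → x ≢ top → x ∈ nonTops k
∈-nonTops⁺ {x = x} x≢ with view x
... | ‵fromℕ     = ⊥-elim (x≢ refl)
... | ‵inject₁ i = ∈-map⁺ inject₁ (∈-allFin i)

∈-nonTops⁻ : ∀ {k} {x : Letter k} → x ∈ nonTops k → x ≢ top
∈-nonTops⁻ x∈ eq with _ , _ , refl ← ∈-map⁻ inject₁ x∈ = Fin.fromℕ≢inject₁ (sym eq)

nonTops-unique : ∀ k → Unique (nonTops k)
nonTops-unique k = Unique.map⁺ Fin.inject₁-injective (Unique.allFin⁺ k)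

length-nonTops : ∀ k → length (nonTops k) ≡ k
length-nonTops k = trans (List.length-map inject₁ (allFin k)) (List.length-tabulate (λ i → i))

-- The letters 1, ..., k-1 for k = `suc j`: the shift by `suc` excludes `zero`, and `nonTops`
-- excludes `top`.
middles : ∀ j → List (Letter (suc j))
middles j = map suc (nonTops j)

∈-middles⁺ : ∀ {j} {x : Letter (suc j)} → x ≢ zero → x ≢ top → x ∈ middles j
∈-middles⁺ {x = zero}  x≢0 _  = ⊥-elim (x≢0 refl)
∈-middles⁺ {x = suc x} _   x≢ = ∈-map⁺ suc (∈-nonTops⁺ (x≢ ∘ cong suc))

∈-middles⁻ : ∀ {j} {x : Letter (suc j)} → x ∈ middles j → x ≢ zero × x ≢ top
∈-middles⁻ x∈ with _ , y∈ , refl ← ∈-map⁻ suc x∈ = (λ ()) , ∈-nonTops⁻ y∈ ∘ Fin.suc-injective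

length-middles : ∀ j → length (middles j) ≡ j
length-middles j = trans (List.length-map suc (nonTops j)) (length-nonTops j)

prependDouble : ∀ {n k} → Word n k → Word (suc (suc n)) k
prependDouble w = top ∷ top ∷ w

prependDouble-injective : ∀ {n k} {u v : Word n k} → prependDouble u ≡ prependDouble v → u ≡ v
prependDouble-injective refl = refl

-- A word of length 1 has no room for a double block. The empty list there lets one splitting cover
-- both the initial value and the recurrence.
doubleVertices : ∀ n k → List (Word (suc n) k)
doubleVertices zero    k = []
doubleVertices (suc n) k = map prependDouble (vertices n k)

letterVertices : ∀ n k → List (Word (suc n) k)
letterVertices n k = cartesianProductWith _∷_ (nonTops k) (vertices n k)

-- The first component is used for disjointness from `letterVertices`, the second for membership in
-- `vertices`.
∈-doubleVertices⁻ : ∀ n {k x} {w : Word n k} → x ∷ w ∈ doubleVertices n k →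
  x ≡ top × Concatenation (toList (x ∷ w))
∈-doubleVertices⁻ (suc n) w∈ with _ , v∈ , refl ← ∈-map⁻ prependDouble w∈ =
  refl , double (∈-vertices⁻ v∈)

∈-letterVertices⁻ : ∀ n {k x} {w : Word n k} → x ∷ w ∈ letterVertices n k →
  x ≢ top × Concatenation (toList (x ∷ w))
∈-letterVertices⁻ n {k} w∈
  with _ , _ , x∈ , v∈ , refl ← ∈-cartesianProductWith⁻ _∷_ (nonTops k) (vertices n k) w∈ =
  ∈-nonTops⁻ x∈ , letter (∈-nonTops⁻ x∈) (∈-vertices⁻ v∈)

vertices-suc : ∀ n k {w : Word (suc n) k} →
  w ∈ vertices (suc n) k ⇔ w ∈ letterVertices n k ++ doubleVertices n k
vertices-suc n k {w} = mk⇔ (to ∘ factor w ∘ ∈-vertices⁻) (from w)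
  where
  to : ∀ {n} {w : Word (suc n) k} → Factored w → w ∈ letterVertices n k ++ doubleVertices n k
  to (letter x≢ c) = ∈-++⁺ˡ (∈-cartesianProductWith⁺ _∷_ (∈-nonTops⁺ x≢) (∈-vertices⁺ c))
  to {suc n} (double c) =
    ∈-++⁺ʳ (letterVertices (suc n) k) (∈-map⁺ prependDouble (∈-vertices⁺ c))

  from : ∀ w → w ∈ letterVertices n k ++ doubleVertices n k → w ∈ vertices (suc n) k
  from (x ∷ w) w∈ = ∈-vertices⁺
    ([ proj₂ ∘ ∈-letterVertices⁻ n , proj₂ ∘ ∈-doubleVertices⁻ n ]′ (∈-++⁻ (letterVertices n k) w∈))

doubleVertices-unique : ∀ n k → Unique (doubleVertices n k)
doubleVertices-unique zero    k = AllPairs.[]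
doubleVertices-unique (suc n) k = Unique.map⁺ prependDouble-injective (vertices-unique n k)

∣vertices∣-suc : ∀ n k →
  length (vertices (suc n) k) ≡ k ℕ.* length (vertices n k) ℕ.+ length (doubleVertices n k)
∣vertices∣-suc n k = begin
  length (vertices (suc n) k)
    ≡⟨ unique-length (vertices-unique (suc n) k) (Unique.++⁺
         (Unique.cartesianProductWith⁺ _∷_ Vec.∷-injective (nonTops-unique k) (vertices-unique n k))
         (doubleVertices-unique n k) disjoint) (vertices-suc n k) ⟩
  length (letterVertices n k ++ doubleVertices n k)
    ≡⟨ List.length-++ (letterVertices n k) ⟩
  length (letterVertices n k) ℕ.+ length (doubleVertices n k)
    ≡⟨ cong (ℕ._+ length (doubleVertices n k)) (length-cartesianProductWith _∷_ (nonTops k) (vertices n k)) ⟩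
  length (nonTops k) ℕ.* length (vertices n k) ℕ.+ length (doubleVertices n k)
    ≡⟨ cong (λ m → m ℕ.* length (vertices n k) ℕ.+ length (doubleVertices n k)) (length-nonTops k) ⟩
  k ℕ.* length (vertices n k) ℕ.+ length (doubleVertices n k) ∎
  where
  disjoint : Disjoint (letterVertices n k) (doubleVertices n k)
  disjoint {x ∷ w} (l , d) = proj₁ (∈-letterVertices⁻ n l) (proj₁ (∈-doubleVertices⁻ n d))

-- Splitting the arcs by their first block

keepLetter : ∀ {n k} → Letter k → Arc n k → Arc (suc n) k
keepLetter x (u , v) = x ∷ u , x ∷ v

keepDouble : ∀ {n k} → Arc n k → Arc (suc (suc n)) k
keepDouble (u , v) = prependDouble u , prependDouble v

changeLetter : ∀ {n k} → Letter k → Word n k → Arc (suc n) k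
changeLetter i w = zero ∷ w , i ∷ w

changeDouble : ∀ {n k} → Word n k → Arc (suc (suc n)) k
changeDouble w = zero ∷ zero ∷ w , prependDouble w

keepLetterArcs : ∀ n j → List (Arc (suc n) (suc j))
keepLetterArcs n j = cartesianProductWith keepLetter (nonTops (suc j)) (arcs n (suc j))

changeLetterArcs : ∀ n j → List (Arc (suc n) (suc j))
changeLetterArcs n j = cartesianProductWith changeLetter (middles j) (vertices n (suc j))

keepDoubleArcs : ∀ n j → List (Arc (suc n) (suc j))
keepDoubleArcs zero    j = []
keepDoubleArcs (suc n) j = map keepDouble (arcs n (suc j))

changeDoubleArcs : ∀ n j → List (Arc (suc n) (suc j))
changeDoubleArcs zero    j = []
changeDoubleArcs (suc n) j = map changeDouble (vertices n (suc j))

splitArcs : ∀ n j → List (Arc (suc n) (suc j))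
splitArcs n j =
  keepLetterArcs n j ++ changeLetterArcs n j ++ keepDoubleArcs n j ++ changeDoubleArcs n j

module _ {j : ℕ} where

  private
    IsArc : ∀ {n} → Word n (suc j) → Word n (suc j) → Set
    IsArc u v = Concatenation (toList u) × Concatenation (toList v) × u ⇝ v

  -- Two questions tell the four families of arcs apart: whether the first letters `x` and `y`
  -- agree, and whether `y` is `top`. Each of the four inversions records its answers next to the
  -- arc itself, and disjointness follows from them.
  ∈-keepLetterArcs⁻ : ∀ n {x y} {u v : Word n (suc j)} →
    (x ∷ u , y ∷ v) ∈ keepLetterArcs n j → (x ≡ y × y ≢ top) × IsArc (x ∷ u) (y ∷ v)
  ∈-keepLetterArcs⁻ n a∈
    with _ , _ , x∈ , uv∈ , refl ← ∈-cartesianProductWith⁻ keepLetter (nonTops (suc j)) (arcs n (suc j)) a∈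
    with cu , cv , r ← ∈-arcs⁻ uv∈
    = (refl , ∈-nonTops⁻ x∈) , letter (∈-nonTops⁻ x∈) cu , letter (∈-nonTops⁻ x∈) cv , there _ r

  ∈-changeLetterArcs⁻ : ∀ n {x y} {u v : Word n (suc j)} →
    (x ∷ u , y ∷ v) ∈ changeLetterArcs n j → (x ≢ y × y ≢ top) × IsArc (x ∷ u) (y ∷ v)
  ∈-changeLetterArcs⁻ n a∈
    with i , _ , i∈ , w∈ , refl ← ∈-cartesianProductWith⁻ changeLetter (middles j) (vertices n (suc j)) a∈
    with i≢0 , i≢k ← ∈-middles⁻ i∈
    = (i≢0 ∘ sym , i≢k) , letter (λ ()) (∈-vertices⁻ w∈) , letter i≢k (∈-vertices⁻ w∈) , single i i≢0 i≢k

  ∈-keepDoubleArcs⁻ : ∀ n {x y} {u v : Word n (suc j)} →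
    (x ∷ u , y ∷ v) ∈ keepDoubleArcs n j → (x ≡ y × y ≡ top) × IsArc (x ∷ u) (y ∷ v)
  ∈-keepDoubleArcs⁻ (suc n) a∈
    with _ , uv∈ , refl ← ∈-map⁻ keepDouble a∈
    with cu , cv , r ← ∈-arcs⁻ uv∈
    = (refl , refl) , double cu , double cv , there _ (there _ r)

  ∈-changeDoubleArcs⁻ : ∀ n {x y} {u v : Word n (suc j)} →
    (x ∷ u , y ∷ v) ∈ changeDoubleArcs n j → (x ≢ y × y ≡ top) × IsArc (x ∷ u) (y ∷ v)
  ∈-changeDoubleArcs⁻ (suc n) a∈ with _ , w∈ , refl ← ∈-map⁻ changeDouble a∈
    = ((λ ()) , refl) , letter (λ ()) (letter (λ ()) (∈-vertices⁻ w∈)) , double (∈-vertices⁻ w∈) , pair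

  ∈-splitArcs⁺ : ∀ {n} {u v : Word (suc n) (suc j)} →
    Factored u → Factored v → u ⇝ v → (u , v) ∈ splitArcs n j
  ∈-splitArcs⁺ {n} (letter _ c) _ (single i i≢0 i≢k) =
    ∈-++⁺ʳ (keepLetterArcs n j) (∈-++⁺ˡ
      (∈-cartesianProductWith⁺ changeLetter (∈-middles⁺ i≢0 i≢k) (∈-vertices⁺ c)))
  -- The target of `pair` begins with `top`, so its first block is not a single letter.
  ∈-splitArcs⁺ {suc n} _ (letter x≢ _) pair = ⊥-elim (x≢ refl)
  ∈-splitArcs⁺ {suc n} _ (double c) pair =
    ∈-++⁺ʳ (keepLetterArcs (suc n) j) (∈-++⁺ʳ (changeLetterArcs (suc n) j)
      (∈-++⁺ʳ (keepDoubleArcs (suc n) j) (∈-map⁺ changeDouble (∈-vertices⁺ c))))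
  ∈-splitArcs⁺ (letter x≢ cu) (letter _ cv) (there x r) =
    ∈-++⁺ˡ (∈-cartesianProductWith⁺ keepLetter (∈-nonTops⁺ x≢) (∈-arcs⁺ cu cv r))
  -- `there` keeps the first letter, so the two ends cannot begin with blocks of different kinds.
  ∈-splitArcs⁺ (letter x≢ _) (double _) (there _ _) = ⊥-elim (x≢ refl)
  ∈-splitArcs⁺ (double _) (letter x≢ _) (there _ _) = ⊥-elim (x≢ refl)
  -- As `top` is not `zero`, no replacement starts inside the double block, and the arc descends
  -- past both of its letters.
  ∈-splitArcs⁺ {suc n} (double cu) (double cv) (there _ (there _ r)) =
    ∈-++⁺ʳ (keepLetterArcs (suc n) j) (∈-++⁺ʳ (changeLetterArcs (suc n) j)
      (∈-++⁺ˡ (∈-map⁺ keepDouble (∈-arcs⁺ cu cv r))))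

  ∈-splitArcs⁻ : ∀ n {x y} {u v : Word n (suc j)} →
    (x ∷ u , y ∷ v) ∈ splitArcs n j → IsArc (x ∷ u) (y ∷ v)
  ∈-splitArcs⁻ n a∈ with ∈-++⁻ (keepLetterArcs n j) a∈
  ... | inj₁ p = proj₂ (∈-keepLetterArcs⁻ n p)
  ... | inj₂ a∈ with ∈-++⁻ (changeLetterArcs n j) a∈
  ...   | inj₁ p = proj₂ (∈-changeLetterArcs⁻ n p)
  ...   | inj₂ a∈ with ∈-++⁻ (keepDoubleArcs n j) a∈
  ...     | inj₁ p = proj₂ (∈-keepDoubleArcs⁻ n p)
  ...     | inj₂ p = proj₂ (∈-changeDoubleArcs⁻ n p)

  arcs-suc : ∀ n {a} → a ∈ arcs (suc n) (suc j) ⇔ a ∈ splitArcs n j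
  arcs-suc n {x ∷ u , y ∷ v} = mk⇔
    (λ a∈ → let cu , cv , r = ∈-arcs⁻ a∈ in ∈-splitArcs⁺ (factor _ cu) (factor _ cv) r)
    (λ a∈ → let cu , cv , r = ∈-splitArcs⁻ n a∈ in ∈-arcs⁺ cu cv r)

  keepDoubleArcs-unique : ∀ n → Unique (keepDoubleArcs n j)
  keepDoubleArcs-unique zero    = AllPairs.[]
  keepDoubleArcs-unique (suc n) = Unique.map⁺ (λ { refl → refl }) (arcs-unique n (suc j))

  changeDoubleArcs-unique : ∀ n → Unique (changeDoubleArcs n j)
  changeDoubleArcs-unique zero    = AllPairs.[]
  changeDoubleArcs-unique (suc n) = Unique.map⁺ (λ { refl → refl }) (vertices-unique n (suc j))

  splitArcs-unique : ∀ n → Unique (splitArcs n j)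
  splitArcs-unique n =
    Unique.++⁺ (Unique.cartesianProductWith⁺ keepLetter (λ { refl → refl , refl })
                 (nonTops-unique (suc j)) (arcs-unique n (suc j)))
      (Unique.++⁺ (Unique.cartesianProductWith⁺ changeLetter (λ { refl → refl , refl })
                    (Unique.map⁺ Fin.suc-injective (nonTops-unique j)) (vertices-unique n (suc j)))
        (Unique.++⁺ (keepDoubleArcs-unique n) (changeDoubleArcs-unique n) disjoint₃)
        disjoint₂)
      disjoint₁
    where
    disjoint₃ : Disjoint (keepDoubleArcs n j) (changeDoubleArcs n j)
    disjoint₃ {_ ∷ _ , _ ∷ _} (p , q) =
      proj₁ (proj₁ (∈-changeDoubleArcs⁻ n q)) (proj₁ (proj₁ (∈-keepDoubleArcs⁻ n p)))

    disjoint₂ : Disjoint (changeLetterArcs n j) (keepDoubleArcs n j ++ changeDoubleArcs n j)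
    disjoint₂ {_ ∷ _ , _ ∷ _} (p , q) = proj₂ (proj₁ (∈-changeLetterArcs⁻ n p))
      ([ proj₂ ∘ proj₁ ∘ ∈-keepDoubleArcs⁻ n , proj₂ ∘ proj₁ ∘ ∈-changeDoubleArcs⁻ n ]′
        (∈-++⁻ (keepDoubleArcs n j) q))

    disjoint₁ : Disjoint (keepLetterArcs n j)
      (changeLetterArcs n j ++ keepDoubleArcs n j ++ changeDoubleArcs n j)
    -- Changed letters are excluded by agreement of the first letters, double blocks by `y ≢ top`.
    disjoint₁ {_ ∷ _ , _ ∷ _} (p , q) with ∈-++⁻ (changeLetterArcs n j) q
    ... | inj₁ q = proj₁ (proj₁ (∈-changeLetterArcs⁻ n q)) (proj₁ (proj₁ (∈-keepLetterArcs⁻ n p)))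
    ... | inj₂ q = proj₂ (proj₁ (∈-keepLetterArcs⁻ n p))
      ([ proj₂ ∘ proj₁ ∘ ∈-keepDoubleArcs⁻ n , proj₂ ∘ proj₁ ∘ ∈-changeDoubleArcs⁻ n ]′
        (∈-++⁻ (keepDoubleArcs n j) q))

  -- The counts of double blocks stay unevaluated: they vanish for `n = 0`, which gives E(1), and
  -- are E(m) and V(m) for `n = suc m`.
  ∣arcs∣-suc : ∀ n → length (arcs (suc n) (suc j)) ≡
    suc j ℕ.* length (arcs n (suc j)) ℕ.+ j ℕ.* length (vertices n (suc j)) ℕ.+
      (length (keepDoubleArcs n j) ℕ.+ length (changeDoubleArcs n j))
  ∣arcs∣-suc n = begin
    length (arcs (suc n) (suc j))
      ≡⟨ unique-length (arcs-unique (suc n) (suc j)) (splitArcs-unique n) (arcs-suc n) ⟩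
    length (as ++ bs ++ cs ++ ds)
      ≡⟨ List.length-++ as ⟩
    length as ℕ.+ length (bs ++ cs ++ ds)
      ≡⟨ cong (length as ℕ.+_) (List.length-++ bs) ⟩
    length as ℕ.+ (length bs ℕ.+ length (cs ++ ds))
      ≡⟨ ℕ.+-assoc (length as) (length bs) _ ⟨
    length as ℕ.+ length bs ℕ.+ length (cs ++ ds)
      ≡⟨ cong₂ ℕ._+_ (cong₂ ℕ._+_
           (trans (length-cartesianProductWith keepLetter (nonTops (suc j)) (arcs n (suc j)))
                  (cong (ℕ._* length (arcs n (suc j))) (length-nonTops (suc j))))
           (trans (length-cartesianProductWith changeLetter (middles j) (vertices n (suc j)))
                  (cong (ℕ._* length (vertices n (suc j))) (length-middles j))))
           (List.length-++ cs) ⟩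
    suc j ℕ.* length (arcs n (suc j)) ℕ.+ j ℕ.* length (vertices n (suc j)) ℕ.+
      (length cs ℕ.+ length ds) ∎
    where
    as bs cs ds : List (Arc (suc n) (suc j))
    as = keepLetterArcs n j
    bs = changeLetterArcs n j
    cs = keepDoubleArcs n j
    ds = changeDoubleArcs n j

-- Formal power series

-- By computation `(f * g) (suc n)` is `f 0 ℤ.* g (suc n) ℤ.+ (tail f * g) n`. The inductions on
-- products run on this unfolding, with `f` replaced by `tail f`.
tail : Series → Series
tail f n = f (suc n)

scale : ℤ → Series → Series
scale c f n = c ℤ.* f n

*-cong : ∀ {f f′ g g′} → f ≈ f′ → g ≈ g′ → f * g ≈ f′ * g′
*-cong p q zero    = cong (ℤ._+ 0ℤ) (cong₂ ℤ._*_ (p 0) (q 0))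
*-cong p q (suc n) = cong₂ ℤ._+_ (cong₂ ℤ._*_ (p 0) (q (suc n)))
                                 (*-cong (λ m → p (suc m)) q n)

*-congˡ : ∀ f {g g′} → g ≈ g′ → f * g ≈ f * g′
*-congˡ f = *-cong {f} (λ _ → refl)

*-congʳ : ∀ {f f′} g → f ≈ f′ → f * g ≈ f′ * g
*-congʳ g p = *-cong {g = g} p (λ _ → refl)

*-distribʳ-+ : ∀ f g h → (f + g) * h ≈ f * h + g * h
*-distribʳ-+ f g h zero    = lemma (f 0) (g 0) (h 0)
  where
  lemma : ∀ x y z → (x ℤ.+ y) ℤ.* z ℤ.+ 0ℤ ≡ (x ℤ.* z ℤ.+ 0ℤ) ℤ.+ (y ℤ.* z ℤ.+ 0ℤ)
  lemma = ℤ-solve-∀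
*-distribʳ-+ f g h (suc n) =
  trans (cong (λ z → (f 0 ℤ.+ g 0) ℤ.* h (suc n) ℤ.+ z) (*-distribʳ-+ (tail f) (tail g) h n))
        (lemma (f 0) (g 0) (h (suc n)) _ _)
  where
  lemma : ∀ x y z u v → (x ℤ.+ y) ℤ.* z ℤ.+ (u ℤ.+ v) ≡ (x ℤ.* z ℤ.+ u) ℤ.+ (y ℤ.* z ℤ.+ v)
  lemma = ℤ-solve-∀

*-scaleˡ : ∀ c f g → scale c f * g ≈ scale c (f * g)
*-scaleˡ c f g zero    = lemma c (f 0) (g 0)
  where
  lemma : ∀ c x y → c ℤ.* x ℤ.* y ℤ.+ 0ℤ ≡ c ℤ.* (x ℤ.* y ℤ.+ 0ℤ)
  lemma = ℤ-solve-∀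
*-scaleˡ c f g (suc n) =
  trans (cong (λ z → c ℤ.* f 0 ℤ.* g (suc n) ℤ.+ z) (*-scaleˡ c (tail f) g n))
        (lemma c (f 0) (g (suc n)) _)
  where
  lemma : ∀ c x y u → c ℤ.* x ℤ.* y ℤ.+ c ℤ.* u ≡ c ℤ.* (x ℤ.* y ℤ.+ u)
  lemma = ℤ-solve-∀

*-assoc : ∀ f g h → (f * g) * h ≈ f * (g * h)
*-assoc f g h zero = lemma (f 0) (g 0) (h 0)
  where
  lemma : ∀ x y z → (x ℤ.* y ℤ.+ 0ℤ) ℤ.* z ℤ.+ 0ℤ ≡ x ℤ.* (y ℤ.* z ℤ.+ 0ℤ) ℤ.+ 0ℤ
  lemma = ℤ-solve-∀
*-assoc f g h (suc n) = begin
  (f 0 ℤ.* g 0 ℤ.+ 0ℤ) ℤ.* h (suc n) ℤ.+ (tail (f * g) * h) n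
    ≡⟨ cong (λ z → (f 0 ℤ.* g 0 ℤ.+ 0ℤ) ℤ.* h (suc n) ℤ.+ z) (begin
         -- This sum is `tail (f * g)` unfolded.
         ((scale (f 0) (tail g) + tail f * g) * h) n
           ≡⟨ *-distribʳ-+ (scale (f 0) (tail g)) (tail f * g) h n ⟩
         (scale (f 0) (tail g) * h) n ℤ.+ ((tail f * g) * h) n
           ≡⟨ cong₂ ℤ._+_ (*-scaleˡ (f 0) (tail g) h n) (*-assoc (tail f) g h n) ⟩
         f 0 ℤ.* (tail g * h) n ℤ.+ (tail f * (g * h)) n ∎) ⟩
  (f 0 ℤ.* g 0 ℤ.+ 0ℤ) ℤ.* h (suc n) ℤ.+ (f 0 ℤ.* (tail g * h) n ℤ.+ (tail f * (g * h)) n)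
    ≡⟨ lemma (f 0) (g 0) (h (suc n)) ((tail g * h) n) _ ⟩
  f 0 ℤ.* (g 0 ℤ.* h (suc n) ℤ.+ (tail g * h) n) ℤ.+ (tail f * (g * h)) n ∎
  where
  lemma : ∀ x y z u v → (x ℤ.* y ℤ.+ 0ℤ) ℤ.* z ℤ.+ (x ℤ.* u ℤ.+ v) ≡ x ℤ.* (y ℤ.* z ℤ.+ u) ℤ.+ v
  lemma = ℤ-solve-∀

-- The product computes by peeling its left factor; commutativity also needs to peel the right one.
*-sucʳ : ∀ f g n → (f * g) (suc n) ≡ f (suc n) ℤ.* g 0 ℤ.+ (f * tail g) n
*-sucʳ f g zero = lemma (f 0 ℤ.* g 1) (f 1 ℤ.* g 0)
  where
  lemma : ∀ x y → x ℤ.+ (y ℤ.+ 0ℤ) ≡ y ℤ.+ (x ℤ.+ 0ℤ)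
  lemma = ℤ-solve-∀
*-sucʳ f g (suc n) =
  trans (cong (λ z → f 0 ℤ.* g (suc (suc n)) ℤ.+ z) (*-sucʳ (tail f) g n))
        (lemma (f 0 ℤ.* g (suc (suc n))) (f (suc (suc n)) ℤ.* g 0) _)
  where
  lemma : ∀ x y z → x ℤ.+ (y ℤ.+ z) ≡ y ℤ.+ (x ℤ.+ z)
  lemma = ℤ-solve-∀

*-comm : ∀ f g → f * g ≈ g * f
*-comm f g zero    = cong (ℤ._+ 0ℤ) (ℤ.*-comm (f 0) (g 0))
*-comm f g (suc n) = trans (cong₂ ℤ._+_ (ℤ.*-comm (f 0) (g (suc n))) (*-comm (tail f) g n))
                           (sym (*-sucʳ g f n))

zero-* : ∀ f g → (∀ i → f i ≡ 0ℤ) → ∀ n → (f * g) n ≡ 0ℤ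
zero-* f g f≡0 zero    rewrite f≡0 0 = refl
zero-* f g f≡0 (suc n) rewrite f≡0 0 = trans (ℤ.+-identityˡ _) (zero-* (tail f) g (λ i → f≡0 (suc i)) n)

constant-* : ∀ f g → (∀ i → f (suc i) ≡ 0ℤ) → ∀ n → (f * g) n ≡ f 0 ℤ.* g n
constant-* f g f≡0 zero    = ℤ.+-identityʳ _
constant-* f g f≡0 (suc n) =
  trans (cong (λ z → f 0 ℤ.* g (suc n) ℤ.+ z) (zero-* (tail f) g f≡0 n)) (ℤ.+-identityʳ _)

-- Two terms split off by computation and leave a constant series as left factor. This turns
-- identities with the quadratic numerator and denominator into recurrences.
quadratic-* : ∀ f g → (∀ i → f (suc (suc (suc i))) ≡ 0ℤ) → ∀ n →
  (f * g) (suc (suc n)) ≡ f 0 ℤ.* g (suc (suc n)) ℤ.+ (f 1 ℤ.* g (suc n) ℤ.+ f 2 ℤ.* g n)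
quadratic-* f g f≡0 n = cong (λ z → f 0 ℤ.* g (suc (suc n)) ℤ.+ (f 1 ℤ.* g (suc n) ℤ.+ z))
  (constant-* (tail (tail f)) g f≡0 n)

*-identityˡ : ∀ f → (1ℤ ·t^ 0) * f ≈ f
*-identityˡ f n = trans (constant-* (1ℤ ·t^ 0) f (λ _ → refl) n) (ℤ.*-identityˡ (f n))

*-identityʳ : ∀ f → f * (1ℤ ·t^ 0) ≈ f
*-identityʳ f n = trans (*-comm f (1ℤ ·t^ 0) n) (*-identityˡ f n)

-- The induction follows long division: since `g 0` is 1, the constant terms of `q` and `f` agree,
-- and `tail q` times `g` is the next dividend.
/-unique : ∀ q f g {p : True (g 0 ℤ.≟ 1ℤ)} → q * g ≈ f → q ≈ (f / g) {p}
/-unique q f g {p} qg≈f = go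
  where
  q₀≡f₀ : q 0 ≡ f 0
  q₀≡f₀ = begin
    q 0                 ≡⟨ ℤ.*-identityʳ (q 0) ⟨
    q 0 ℤ.* 1ℤ          ≡⟨ cong (q 0 ℤ.*_) (toWitness p) ⟨
    q 0 ℤ.* g 0         ≡⟨ ℤ.+-identityʳ _ ⟨
    q 0 ℤ.* g 0 ℤ.+ 0ℤ  ≡⟨ qg≈f 0 ⟩
    f 0                 ∎

  cancel : ∀ x y → y ≡ (x ℤ.+ y) ℤ.- x
  cancel = ℤ-solve-∀

  go : q ≈ (f / g) {p}
  go zero    = q₀≡f₀
  go (suc n) = /-unique (tail q) _ g {p} (λ m → begin
    (tail q * g) m                                   ≡⟨ cancel (q 0 ℤ.* g (suc m)) _ ⟩
    (q * g) (suc m) ℤ.- q 0 ℤ.* g (suc m)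
      ≡⟨ cong₂ (λ x y → x ℤ.- y ℤ.* g (suc m)) (qg≈f (suc m)) q₀≡f₀ ⟩
    f (suc m) ℤ.- f 0 ℤ.* g (suc m)                  ∎) n

-- From the recurrences to the rational function

denominator numerator : ℤ → Series
denominator K = 1ℤ ·t^ 0 - K ·t^ 1 - 1ℤ ·t^ 2
numerator   J = J ·t^ 1 + 1ℤ ·t^ 2

module _ {K J : ℤ} {V E : Series}
  (V₀ : V 0 ≡ 1ℤ) (V₁ : V 1 ≡ K ℤ.* V 0)
  (V₂ : ∀ n → V (suc (suc n)) ≡ K ℤ.* V (suc n) ℤ.+ V n)
  (E₀ : E 0 ≡ 0ℤ) (E₁ : E 1 ≡ K ℤ.* E 0 ℤ.+ J ℤ.* V 0)
  (E₂ : ∀ n → E (suc (suc n)) ≡ K ℤ.* E (suc n) ℤ.+ J ℤ.* V (suc n) ℤ.+ (E n ℤ.+ V n))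
  where

  private
    G N : Series
    G = denominator K
    N = numerator J

    denominator*V≈1 : G * V ≈ 1ℤ ·t^ 0
    denominator*V≈1 zero rewrite V₀ = refl
    denominator*V≈1 (suc zero) rewrite V₁ = lemma K (V 0)
      where
      -- `0ℤ ℤ.- k ℤ.- 0ℤ` is the form to which the coefficient `G 1` computes.
      lemma : ∀ k v → 1ℤ ℤ.* (k ℤ.* v) ℤ.+ ((0ℤ ℤ.- k ℤ.- 0ℤ) ℤ.* v ℤ.+ 0ℤ) ≡ 0ℤ
      lemma = ℤ-solve-∀
    denominator*V≈1 (suc (suc n)) = begin
      (G * V) (suc (suc n))  ≡⟨ quadratic-* G V (λ _ → refl) n ⟩
      1ℤ ℤ.* V (suc (suc n)) ℤ.+ (G 1 ℤ.* V (suc n) ℤ.+ G 2 ℤ.* V n)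
        ≡⟨ cong (λ v → 1ℤ ℤ.* v ℤ.+ (G 1 ℤ.* V (suc n) ℤ.+ G 2 ℤ.* V n)) (V₂ n) ⟩
      _                      ≡⟨ lemma K (V (suc n)) (V n) ⟩
      0ℤ                     ∎
      where
      lemma : ∀ k v w → 1ℤ ℤ.* (k ℤ.* v ℤ.+ w) ℤ.+
        ((0ℤ ℤ.- k ℤ.- 0ℤ) ℤ.* v ℤ.+ (0ℤ ℤ.- 0ℤ ℤ.- 1ℤ) ℤ.* w) ≡ 0ℤ
      lemma = ℤ-solve-∀

    denominator*E≈numerator*V : G * E ≈ N * V
    denominator*E≈numerator*V zero rewrite E₀ | V₀ = refl
    denominator*E≈numerator*V (suc zero) rewrite E₁ = lemma K J (E 0) (V 0)
      where
      lemma : ∀ k j e v → 1ℤ ℤ.* (k ℤ.* e ℤ.+ j ℤ.* v) ℤ.+ ((0ℤ ℤ.- k ℤ.- 0ℤ) ℤ.* e ℤ.+ 0ℤ) ≡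
        0ℤ ℤ.+ ((j ℤ.+ 0ℤ) ℤ.* v ℤ.+ 0ℤ)
      lemma = ℤ-solve-∀
    denominator*E≈numerator*V (suc (suc n)) = begin
      (G * E) (suc (suc n))  ≡⟨ quadratic-* G E (λ _ → refl) n ⟩
      1ℤ ℤ.* E (suc (suc n)) ℤ.+ (G 1 ℤ.* E (suc n) ℤ.+ G 2 ℤ.* E n)
        ≡⟨ cong (λ e → 1ℤ ℤ.* e ℤ.+ (G 1 ℤ.* E (suc n) ℤ.+ G 2 ℤ.* E n)) (E₂ n) ⟩
      -- `V (suc (suc n))` enters with coefficient `N 0`, which is zero.
      _                      ≡⟨ lemma K J (E (suc n)) (E n) (V (suc (suc n))) (V (suc n)) (V n) ⟩
      N 0 ℤ.* V (suc (suc n)) ℤ.+ (N 1 ℤ.* V (suc n) ℤ.+ N 2 ℤ.* V n)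
        ≡⟨ quadratic-* N V (λ _ → refl) n ⟨
      (N * V) (suc (suc n))  ∎
      where
      lemma : ∀ k j e f u v w →
        1ℤ ℤ.* (k ℤ.* e ℤ.+ j ℤ.* v ℤ.+ (f ℤ.+ w)) ℤ.+
          ((0ℤ ℤ.- k ℤ.- 0ℤ) ℤ.* e ℤ.+ (0ℤ ℤ.- 0ℤ ℤ.- 1ℤ) ℤ.* f) ≡
        0ℤ ℤ.* u ℤ.+ ((j ℤ.+ 0ℤ) ℤ.* v ℤ.+ 1ℤ ℤ.* w)
      lemma = ℤ-solve-∀

  -- `V` serves as the inverse of `G`: multiplying `G * E ≈ N * V` by `G` once more cancels `V` and
  -- leaves `N`, and uniqueness of the quotient concludes.
  recurrence⇒quotient : E ≈ numerator J / denominator K ^ 2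
  recurrence⇒quotient = /-unique E N (G ^ 2) λ n → begin
    (E * (G * (G * 1ℤ ·t^ 0))) n  ≡⟨ *-congˡ E (*-congˡ G (*-identityʳ G)) n ⟩
    (E * (G * G)) n               ≡⟨ *-assoc E G G n ⟨
    ((E * G) * G) n               ≡⟨ *-congʳ G (*-comm E G) n ⟩
    ((G * E) * G) n               ≡⟨ *-congʳ G denominator*E≈numerator*V n ⟩
    ((N * V) * G) n               ≡⟨ *-assoc N V G n ⟩
    (N * (V * G)) n               ≡⟨ *-congˡ N (*-comm V G) n ⟩
    (N * (G * V)) n               ≡⟨ *-congˡ N denominator*V≈1 n ⟩
    (N * 1ℤ ·t^ 0) n              ≡⟨ *-identityʳ N n ⟩
    N n                           ∎

-- The recurrences for vertices and arcs over the integers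

module _ (j : ℕ) where

  private
    V E : Series
    V n = + length (vertices n (suc j))
    E n = + length (arcs n (suc j))

  vertexSeries-1 : V 1 ≡ + suc j ℤ.* V 0
  vertexSeries-1 = begin
    V 1                                              ≡⟨ cong +_ (∣vertices∣-suc 0 (suc j)) ⟩
    -- The summand 0 is the length of `doubleVertices 0 (suc j)`.
    + (suc j ℕ.* length (vertices 0 (suc j)) ℕ.+ 0)  ≡⟨ cong +_ (ℕ.+-identityʳ _) ⟩
    + (suc j ℕ.* length (vertices 0 (suc j)))        ≡⟨ ℤ.pos-* (suc j) _ ⟩
    + suc j ℤ.* V 0                                  ∎

  vertexSeries-2+ : ∀ n → V (suc (suc n)) ≡ + suc j ℤ.* V (suc n) ℤ.+ V n
  vertexSeries-2+ n = begin
    V (suc (suc n))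
      ≡⟨ cong +_ (∣vertices∣-suc (suc n) (suc j)) ⟩
    -- Integer addition of nonnegative numbers computes to `+_` of the natural sum, so only products
    -- need a cast lemma.
    + (suc j ℕ.* length (vertices (suc n) (suc j))) ℤ.+ + length (doubleVertices (suc n) (suc j))
      ≡⟨ cong₂ ℤ._+_ (ℤ.pos-* (suc j) _) (cong +_ (List.length-map prependDouble (vertices n (suc j)))) ⟩
    + suc j ℤ.* V (suc n) ℤ.+ V n ∎

  arcSeries-suc : ∀ n → E (suc n) ≡ + suc j ℤ.* E n ℤ.+ + j ℤ.* V n ℤ.+
    (+ length (keepDoubleArcs n j) ℤ.+ + length (changeDoubleArcs n j))
  arcSeries-suc n = begin
    E (suc n)
      ≡⟨ cong +_ (∣arcs∣-suc n) ⟩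
    + (suc j ℕ.* length (arcs n (suc j))) ℤ.+ + (j ℕ.* length (vertices n (suc j))) ℤ.+ doubles
      ≡⟨ cong₂ (λ x y → x ℤ.+ y ℤ.+ doubles)
           (ℤ.pos-* (suc j) (length (arcs n (suc j)))) (ℤ.pos-* j (length (vertices n (suc j)))) ⟩
    + suc j ℤ.* E n ℤ.+ + j ℤ.* V n ℤ.+ doubles ∎
    where
    doubles : ℤ
    doubles = + length (keepDoubleArcs n j) ℤ.+ + length (changeDoubleArcs n j)

  arcSeries-1 : E 1 ≡ + suc j ℤ.* E 0 ℤ.+ + j ℤ.* V 0
  arcSeries-1 = trans (arcSeries-suc 0) (ℤ.+-identityʳ _)

  arcSeries-2+ : ∀ n → E (suc (suc n)) ≡
    + suc j ℤ.* E (suc n) ℤ.+ + j ℤ.* V (suc n) ℤ.+ (E n ℤ.+ V n)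
  arcSeries-2+ n = trans (arcSeries-suc (suc n))
    (cong₂ (λ x y → + suc j ℤ.* E (suc n) ℤ.+ + j ℤ.* V (suc n) ℤ.+ (+ x ℤ.+ + y))
      (List.length-map keepDouble (arcs n (suc j)))
      (List.length-map changeDouble (vertices n (suc j))))

  arcSeries≈quotient : E ≈ numerator (+ j) / denominator (+ suc j) ^ 2
  -- The two `refl` evaluate length 0: the empty string is the only vertex and carries no arc.
  arcSeries≈quotient = recurrence⇒quotient {V = V} refl vertexSeries-1 vertexSeries-2+
    refl arcSeries-1 arcSeries-2+

proposition2p6 : (k : ℕ) → 1 ℕ.≤ k →
    edgeSeries k ≈ ((+ k ℤ.- 1ℤ) ·t^ 1 + 1ℤ ·t^ 2) / (1ℤ ·t^ 0 - (+ k) ·t^ 1 - 1ℤ ·t^ 2) ^ 2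
-- For k = `suc j` the coefficient `+ k ℤ.- 1ℤ` computes to `+ j`.
proposition2p6 (suc j) _ n = trans (cong +_ (∣E∣≡∣arcs∣ n j)) (arcSeries≈quotient j n)
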